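{- Let $n\neq 0$ be an integer and let $K$ be a bicolored $n$-Eulerian cubical complex. Then the same number of vertices of $K$ are assigned each of the two colors; in particular $K$ has an even number of vertices.
   Context: A cubical poset is a poset $P$ in which every order ideal $\{z\in P: z\le x\}$ is isomorphic to a product of copies of $I$, where $I$ is the three-element face poset of an interval with the empty face excluded. A cubical complex is a (regular) cell complex whose face poset $P$ (excluding the empty face) is a cubical poset such that $P$ with a minimum and maximum adjoined is a lattice. A bicoloring assigns to each vertex one of two colors so that every edge has one endpoint of each color. The link of a vertex $v$ is the poset of faces strictly containing $v$; its Euler characteristic is the alternating sum $\sum_{i\ge 1}(-1)^{i-1}(\text{number of } i\text{ -dimensional faces of } K \text{ containing } v)$. The complex $K$ is $n$-Eulerian if the link of every vertex has Euler characteristic $n$. -}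

module Defs where

open import Level using (Level; _⊔_) renaming (suc to lsuc)
open import Data.Bool using (Bool)
import Data.Bool.Properties as Bool
open import Data.Fin using (Fin)
open import Data.Integer using (ℤ; +_; 0ℤ; -1ℤ) renaming (_+_ to _+ℤ_; _*_ to _*ℤ_; _^_ to _^ℤ_)
open import Data.List using (List; allFin; filter; foldr; length; map; mapMaybe; upTo)
open import Data.List.Extrema.Nat using (max)
open import Data.Nat using (ℕ; suc; _≟_)
open import Data.Product using (Σ; ∃; ∃₂; ∃!; _×_; _,_; proj₁)
open import Data.Vec using (Vec)
open import Data.Vec.Relation.Binary.Pointwise.Inductive using (Pointwise)
open import Function using (_on_)
open import Function.Bundles using (_↔_; module Inverse)
open import Relation.Binary using (Rel; IsDecPartialOrder)
open import Relation.Binary.Construct.Add.Extrema.NonStrict using (_≤±_)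
open import Relation.Binary.Lattice using (IsLattice)
open import Relation.Binary.Morphism.Structures using (IsOrderIsomorphism)
open import Relation.Binary.PropositionalEquality using (_≡_)
open import Relation.Nullary.Construct.Add.Extrema using (_±)
open import Relation.Nullary.Decidable using (dec⇒maybe; _×-dec_)
import Data.Maybe as Maybe

private variable
  a ℓ : Level

data I : Set where
  left right whole : I

data _≤ᴵ_ : Rel I Level.zero where
  reflᴵ   : ∀ {x} → x ≤ᴵ x
  ≤-whole : ∀ {x} → x ≤ᴵ whole

OrderIdeal : {A : Set a} → Rel A ℓ → A → Set (a ⊔ ℓ)
OrderIdeal {A = A} _≤_ x = Σ A (_≤ x)

-- Elements of an order ideal are compared through their underlying elements
-- of the poset, so the proofs of `z ≤ x` play no role.
IdealIsCube : {A : Set a} → Rel A ℓ → A → ℕ → Set (a ⊔ ℓ)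
IdealIsCube _≤_ x k =
  Σ (OrderIdeal _≤_ x → Vec I k)
    (IsOrderIsomorphism (_≡_ on proj₁) _≡_ (_≤_ on proj₁) (Pointwise _≤ᴵ_))

IsCubical : {A : Set a} → Rel A ℓ → Set (a ⊔ ℓ)
IsCubical _≤_ = ∀ x → ∃ (IdealIsCube _≤_ x)

IsBoundedExtensionLattice : {A : Set a} → Rel A ℓ → Set (a ⊔ ℓ)
IsBoundedExtensionLattice {A = A} _≤_ =
  ∃₂ (IsLattice {A = A ±} _≡_ (_≤±_ _≤_))

-- A finite cubical complex, given by the poset of its nonempty faces: a regular
-- cell complex is determined up to homeomorphism by this poset, and every
-- cubical poset is the face poset of a regular cell complex.
record CubicalComplex (a ℓ : Level) : Set (lsuc (a ⊔ ℓ)) where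
  field
    Face              : Set a
    _≤_               : Rel Face ℓ
    isDecPartialOrder : IsDecPartialOrder _≡_ _≤_
    size              : ℕ
    enumeration       : Fin size ↔ Face
    isCubical         : IsCubical _≤_
    isLattice         : IsBoundedExtensionLattice _≤_

  open IsDecPartialOrder isDecPartialOrder public using (_≤?_)

  faces : List Face
  faces = map (Inverse.to enumeration) (allFin size)

  -- The order ideal of a k-dimensional face has 3 ^ k elements, so this
  -- exponent does not depend on the chosen isomorphism.
  dim : Face → ℕ
  dim x = proj₁ (isCubical x)

  Vertex : Set a
  Vertex = Σ Face λ x → dim x ≡ 0

  vertices : List Vertex
  vertices = mapMaybe (λ x → Maybe.map (x ,_) (dec⇒maybe (dim x ≟ 0))) faces

  -- The maximal dimension of a face.
  dimension : ℕ
  dimension = max 0 (map dim faces)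

  facesContaining : Vertex → ℕ → ℕ
  facesContaining (v , _) i =
    length (filter (λ F → (v ≤? F) ×-dec (dim F ≟ i)) faces)

  -- The index j is i - 1, so that i = suc j runs through 1, …, dimension; there
  -- are no faces of larger dimension.
  linkEulerCharacteristic : Vertex → ℤ
  linkEulerCharacteristic v =
    foldr _+ℤ_ 0ℤ
      (map (λ j → (-1ℤ ^ℤ j) *ℤ (+ facesContaining v (suc j))) (upTo dimension))

  IsEulerian : ℤ → Set a
  IsEulerian n = ∀ v → linkEulerCharacteristic v ≡ n

  IsBicoloring : (Vertex → Bool) → Set (a ⊔ ℓ)
  IsBicoloring color =
    ∀ e → dim e ≡ 1 → ∀ c →
    ∃! (_≡_ on proj₁) λ (v : Vertex) → proj₁ v ≤ e × color v ≡ c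

  verticesColored : (Vertex → Bool) → Bool → ℕ
  verticesColored color c = length (filter (λ v → color v Bool.≟ c) vertices)

{-# OPTIONS --safe #-}
module Submission where

-- Weight each vertex by ±1 according to its color and sum, over all vertices v,
-- the weight of v times the Euler characteristic of its link: the result is n
-- times the total weight.  Exchanging the sums, a cube F of positive dimension
-- contributes ± the total weight of its vertices, which is zero because the
-- reflection of F in its first coordinate moves each vertex along an edge and
-- so reverses its color.  As n ≠ 0, the total weight is zero.

open import Defs
open import Level using (Level)
open import Data.Bool using (Bool; true; false)
open import Data.Integer using (ℤ; 0ℤ)
open import Data.List using (length)
open import Data.Nat.Divisibility using (_∣_)
open import Data.Product using (_×_)
open import Relation.Binary.PropositionalEquality using (_≡_; _≢_)

import Data.Bool.Properties as Bool
open import Data.Fin using (Fin; zero; suc)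
import Data.Fin.Permutation as Perm
open import Data.Integer using (+_; 1ℤ; -1ℤ; -_; _+_; _*_; _^_)
import Data.Integer.Properties as ℤ
open import Data.List using (List; []; _∷_; filter; foldr; map; mapMaybe; tabulate; upTo)
open import Data.List.Properties using (map-tabulate)
import Data.Maybe as Maybe
open import Data.Nat using (ℕ; zero; suc; _≟_)
import Data.Nat as ℕ
import Data.Nat.Properties as ℕ
open import Data.Nat.Divisibility using (divides)
open import Data.Product using (_,_; proj₁; proj₂)
open import Data.Sum using ([_,_]′)
open import Data.Vec using (Vec; []; _∷_; replicate; tail)
open import Data.Vec.Properties using (∷-injectiveˡ; ∷-injectiveʳ)
open import Data.Vec.Relation.Binary.Pointwise.Inductive as Pointwise using (Pointwise; []; _∷_)
open import Function using (_∘_; id)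
open import Function.Bundles using (module Inverse)
open import Relation.Binary using (IsDecPartialOrder)
open import Relation.Binary.Morphism.Structures using (IsOrderIsomorphism)
open import Relation.Binary.PropositionalEquality
  using (refl; sym; trans; cong; cong₂; subst; subst₂; module ≡-Reasoning)
open import Relation.Nullary using (¬_; Dec; yes; no; contradiction)
open import Relation.Nullary.Decidable using (dec⇒maybe; _×-dec_)
open import Relation.Unary using (Decidable)

open import Algebra.Properties.Semiring.Sum ℤ.+-*-semiring
  using (sum; sum-cong-≗; sum-replicate-zero; ∑-distrib-+; ∑-comm; sum-permute;
         *-distribˡ-sum; *-distribʳ-sum)
open import Algebra.Properties.CommutativeSemigroup ℤ.+-commutativeSemigroup
  using (interchange) renaming (x∙yz≈y∙xz to +-x∙yz≈y∙xz)
open import Algebra.Properties.CommutativeSemigroup ℤ.*-commutativeSemigroup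
  using () renaming (x∙yz≈y∙xz to *-x∙yz≈y∙xz)

private variable
  a ℓ p : Level
  A : Set a

-- Indicators, counting and finite integer sums.

indicator : Dec A → ℤ
indicator (yes _) = 1ℤ
indicator (no _)  = 0ℤ

indicator-× : {B : Set p} (x : Dec A) (y : Dec B) →
              indicator (x ×-dec y) ≡ indicator x * indicator y
indicator-× (yes _) (yes _) = refl
indicator-× (yes _) (no _)  = refl
indicator-× (no _)  _       = refl

sum-zero : ∀ {n} (f : Fin n → ℤ) → (∀ i → f i ≡ 0ℤ) → sum f ≡ 0ℤ
sum-zero {n} f f≡0 = trans (sum-cong-≗ f≡0) (sum-replicate-zero n)

i≡-i⇒i≡0 : ∀ {i} → i ≡ - i → i ≡ 0ℤ
i≡-i⇒i≡0 {+ zero} _ = refl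

-- Reindexing along `π` leaves the sum unchanged but also negates it, and only zero equals its own
-- negative.
sum-antisymmetric : ∀ {n} (f : Fin n → ℤ) (π : Perm.Permutation n n) →
                    (∀ i → f (π Perm.⟨$⟩ʳ i) ≡ - f i) → sum f ≡ 0ℤ
sum-antisymmetric {n} f π anti = i≡-i⇒i≡0 (begin
  sum f                             ≡⟨ sum-permute f π ⟩
  sum (λ i → f (π Perm.⟨$⟩ʳ i))     ≡⟨ sum-cong-≗ anti ⟩
  sum (λ i → - f i)                 ≡⟨ sum-cong-≗ (λ i → sym (ℤ.-1*i≡-i (f i))) ⟩
  sum (λ i → -1ℤ * f i)             ≡⟨ *-distribˡ-sum -1ℤ f ⟨
  -1ℤ * sum f                       ≡⟨ ℤ.-1*i≡-i (sum f) ⟩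
  - sum f                           ∎)
  where open ≡-Reasoning

length-filter-tabulate : {P : A → Set p} (P? : Decidable P) → ∀ {n} (g : Fin n → A) →
                         + length (filter P? (tabulate g)) ≡ sum (λ i → indicator (P? (g i)))
length-filter-tabulate P? {zero}  g = refl
length-filter-tabulate P? {suc n} g with P? (g zero)
... | yes _ = cong (_+_ 1ℤ) (length-filter-tabulate P? (g ∘ suc))
... | no _  = trans (length-filter-tabulate P? (g ∘ suc)) (sym (ℤ.+-identityˡ _))

length-filter-bool : (color : A → Bool) (xs : List A) →
                     length xs ≡ length (filter (λ x → color x Bool.≟ true) xs)
                           ℕ.+ length (filter (λ x → color x Bool.≟ false) xs)
length-filter-bool color []       = refl
length-filter-bool color (x ∷ xs) with color x
... | true  = cong suc (length-filter-bool color xs)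
... | false = trans (cong suc (length-filter-bool color xs)) (sym (ℕ.+-suc _ _))

-- Exchanges the sum over `i` with the fold over `js`, one entry at a time. The fold has the shape
-- of the alternating sum that defines the Euler characteristic of a link.
sum-*-foldr-zero : ∀ {m} (w : Fin m → ℤ) (h : Fin m → ℕ → ℤ) →
                   (∀ j → sum (λ i → w i * h i j) ≡ 0ℤ) →
                   ∀ js → sum (λ i → w i * foldr _+_ 0ℤ (map (h i) js)) ≡ 0ℤ
sum-*-foldr-zero w h eq []       = sum-zero _ λ i → ℤ.*-zeroʳ (w i)
sum-*-foldr-zero w h eq (j ∷ js) = begin
  sum (λ i → w i * (h i j + r i))
    ≡⟨ sum-cong-≗ (λ i → ℤ.*-distribˡ-+ (w i) (h i j) (r i)) ⟩
  sum (λ i → w i * h i j + w i * r i)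
    ≡⟨ ∑-distrib-+ (λ i → w i * h i j) (λ i → w i * r i) ⟩
  sum (λ i → w i * h i j) + sum (λ i → w i * r i)
    ≡⟨ cong₂ _+_ (eq j) (sum-*-foldr-zero w h eq js) ⟩
  0ℤ ∎
  where
  open ≡-Reasoning
  r = λ i → foldr _+_ 0ℤ (map (h i) js)

-- Signs of colors and the reflection of coordinate vectors.

sign : Bool → ℤ
sign true  = 1ℤ
sign false = -1ℤ

sign-≢ : ∀ {b c} → b ≢ c → sign b ≡ - sign c
sign-≢ {true}  {true}  b≢c = contradiction refl b≢c
sign-≢ {true}  {false} _   = refl
sign-≢ {false} {true}  _   = refl
sign-≢ {false} {false} b≢c = contradiction refl b≢c

opposite : I → I
opposite left  = right
opposite right = left
opposite whole = whole

opposite-involutive : ∀ h → opposite (opposite h) ≡ h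
opposite-involutive left  = refl
opposite-involutive right = refl
opposite-involutive whole = refl

flip : ∀ {k} → Vec I (suc k) → Vec I (suc k)
flip (h ∷ u) = opposite h ∷ u

flip-involutive : ∀ {k} (w : Vec I (suc k)) → flip (flip w) ≡ w
flip-involutive (h ∷ u) = cong (_∷ u) (opposite-involutive h)

≤ᵛ-refl : ∀ {k} {w : Vec I k} → Pointwise _≤ᴵ_ w w
≤ᵛ-refl = Pointwise.refl reflᴵ

flip-mono : ∀ {k} {w w′ : Vec I (suc k)} → Pointwise _≤ᴵ_ w w′ → Pointwise _≤ᴵ_ (flip w) (flip w′)
flip-mono (reflᴵ   ∷ u≤u′) = reflᴵ ∷ u≤u′
flip-mono (≤-whole ∷ u≤u′) = ≤-whole ∷ u≤u′

≤-replicate-whole : ∀ {k} (w : Vec I k) → Pointwise _≤ᴵ_ w (replicate k whole)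
≤-replicate-whole []      = []
≤-replicate-whole (h ∷ u) = ≤-whole ∷ ≤-replicate-whole u

-- Coordinates on order ideals, and vertices as minimal faces.

module _ (K : CubicalComplex a ℓ) where
  open CubicalComplex K
  private module ≤ = IsDecPartialOrder isDecPartialOrder

  -- An order-theoretic description of vertices: unlike `dim`, which is read off from a chosen
  -- isomorphism for each face, it transfers directly along order-preserving bijections.
  Minimal : Face → Set _
  Minimal x = ∀ {y} → y ≤ x → y ≡ x

  module Cube {x k} (cube : IdealIsCube _≤_ x k) where
    open IsOrderIsomorphism (proj₂ cube) public using (mono; cancel; injective)
    open IsOrderIsomorphism (proj₂ cube) using (surjective) renaming (cong to φ-cong)

    coord : ∀ {z} → z ≤ x → Vec I k
    coord z≤x = proj₁ cube (_ , z≤x)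

    face : Vec I k → Face
    face w = proj₁ (proj₁ (surjective w))

    face≤ : ∀ w → face w ≤ x
    face≤ w = proj₂ (proj₁ (surjective w))

    coord-cong : ∀ {y z} (y≤x : y ≤ x) (z≤x : z ≤ x) → y ≡ z → coord y≤x ≡ coord z≤x
    coord-cong _ _ = φ-cong

    coord-face : ∀ {w} (w≤x : face w ≤ x) → coord w≤x ≡ w
    coord-face {w} _ = proj₂ (surjective w) refl

    face-coord : ∀ {z} (z≤x : z ≤ x) → face (coord z≤x) ≡ z
    face-coord z≤x = injective (coord-face (face≤ _))

    face-injective : ∀ {w w′} → face w ≡ face w′ → w ≡ w′
    face-injective {w} {w′} eq =
      trans (sym (coord-face (face≤ w))) (trans (coord-cong _ _ eq) (coord-face (face≤ w′)))

    face-mono : ∀ {w w′} → Pointwise _≤ᴵ_ w w′ → face w ≤ face w′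
    face-mono {w} {w′} w≤w′ =
      cancel {_ , face≤ w} {_ , face≤ w′}
        (subst₂ (Pointwise _≤ᴵ_) (sym (coord-face _)) (sym (coord-face _)) w≤w′)

  idealCube : ∀ {x k} → dim x ≡ k → IdealIsCube _≤_ x k
  idealCube {x} refl = proj₂ (isCubical x)

  -- `Vec I 0` has a single element, so the order ideal of `x` has only one face.
  dim≡0⇒minimal : ∀ {x} → dim x ≡ 0 → Minimal x
  dim≡0⇒minimal {x} dx y≤x = injective (unique (coord y≤x) (coord ≤.refl))
    where
    open Cube (idealCube dx)
    unique : (u w : Vec I 0) → u ≡ w
    unique [] [] = refl

  -- In a cube of positive dimension the all-`left` and all-`whole` vectors give distinct faces
  -- below `x`, whereas minimality makes both equal to `x`.
  minimal⇒dim≡0 : ∀ {x} → Minimal x → dim x ≡ 0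
  minimal⇒dim≡0 {x} min = go _ refl
    where
    go : ∀ k → dim x ≡ k → k ≡ 0
    go zero    _  = refl
    go (suc k) dx = contradiction
      (face-injective (trans (min (face≤ (replicate (suc k) left)))
                             (sym (min (face≤ (replicate (suc k) whole))))))
      λ ()
      where open Cube (idealCube dx)

  -- Reflection of a cube in its first coordinate.

  module Reflection {F k} (cube : IdealIsCube _≤_ F (suc k)) where
    open Cube cube

    -- Faces outside the cube `F` are fixed, so that the reflection is an involution of all faces
    -- and can reindex sums over the whole complex.
    reflect? : ∀ {z} → Dec (z ≤ F) → Face
    reflect? {z} (yes z≤F) = face (flip (coord z≤F))
    reflect? {z} (no _)    = z

    reflect : Face → Face
    reflect z = reflect? (z ≤? F)

    reflect-≤ : ∀ {z} (z≤F : z ≤ F) → reflect z ≡ face (flip (coord z≤F))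
    reflect-≤ {z} z≤F with z ≤? F
    ... | yes z≤F′ = cong (face ∘ flip) (coord-cong z≤F′ z≤F refl)
    ... | no z≰F   = contradiction z≤F z≰F

    reflect-≰ : ∀ {z} → ¬ z ≤ F → reflect z ≡ z
    reflect-≰ {z} z≰F with z ≤? F
    ... | yes z≤F = contradiction z≤F z≰F
    ... | no _    = refl

    reflect≤ : ∀ {z} → z ≤ F → reflect z ≤ F
    reflect≤ z≤F = subst (_≤ F) (sym (reflect-≤ z≤F)) (face≤ _)

    coord-reflect : ∀ {z} (z≤F : z ≤ F) (rz≤F : reflect z ≤ F) → coord rz≤F ≡ flip (coord z≤F)
    coord-reflect z≤F rz≤F =
      trans (coord-cong rz≤F (face≤ _) (reflect-≤ z≤F)) (coord-face (face≤ _))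

    reflect-involutive : ∀ z → reflect (reflect z) ≡ z
    reflect-involutive z = go (z ≤? F)
      where
      go : Dec (z ≤ F) → reflect (reflect z) ≡ z
      go (yes z≤F) = begin
        reflect (reflect z)                ≡⟨ reflect-≤ (reflect≤ z≤F) ⟩
        face (flip (coord (reflect≤ z≤F))) ≡⟨ cong (face ∘ flip) (coord-reflect z≤F _) ⟩
        face (flip (flip (coord z≤F)))     ≡⟨ cong face (flip-involutive _) ⟩
        face (coord z≤F)                   ≡⟨ face-coord z≤F ⟩
        z                                  ∎
        where open ≡-Reasoning
      go (no z≰F) = trans (cong reflect (reflect-≰ z≰F)) (reflect-≰ z≰F)

    reflect-mono : ∀ {y z} → y ≤ F → z ≤ F → y ≤ z → reflect y ≤ reflect z
    reflect-mono y≤F z≤F y≤z =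
      subst₂ _≤_ (sym (reflect-≤ y≤F)) (sym (reflect-≤ z≤F)) (face-mono (flip-mono (mono y≤z)))

    -- A face below `reflect z` is reflected to a face below `z`, hence to `z` itself; reflecting
    -- back identifies it with `reflect z`.
    reflect-minimal : ∀ {z} → z ≤ F → Minimal z → Minimal (reflect z)
    reflect-minimal {z} z≤F min {y} y≤rz = begin
      y                   ≡⟨ reflect-involutive y ⟨
      reflect (reflect y) ≡⟨ cong reflect (min ry≤z) ⟩
      reflect z           ∎
      where
      open ≡-Reasoning
      ry≤z : reflect y ≤ z
      ry≤z = subst (reflect y ≤_) (reflect-involutive z)
               (reflect-mono (≤.trans y≤rz (reflect≤ z≤F)) (reflect≤ z≤F) y≤rz)

    -- For a vertex `z`, this is the edge that joins it to its mirror image.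
    edge : ∀ {z} → z ≤ F → Face
    edge z≤F = face (whole ∷ tail (coord z≤F))

    z≤edge : ∀ {z} (z≤F : z ≤ F) → z ≤ edge z≤F
    z≤edge {z} z≤F = subst (_≤ edge z≤F) (face-coord z≤F) (face-mono (go (coord z≤F)))
      where
      go : ∀ {k} (w : Vec I (suc k)) → Pointwise _≤ᴵ_ w (whole ∷ tail w)
      go (_ ∷ _) = ≤-whole ∷ ≤ᵛ-refl

    reflect≤edge : ∀ {z} (z≤F : z ≤ F) → reflect z ≤ edge z≤F
    reflect≤edge {z} z≤F = subst (_≤ edge z≤F) (sym (reflect-≤ z≤F)) (face-mono (go (coord z≤F)))
      where
      go : ∀ {k} (w : Vec I (suc k)) → Pointwise _≤ᴵ_ (flip w) (whole ∷ tail w)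
      go (_ ∷ _) = ≤-whole ∷ ≤ᵛ-refl

    minimal-vec : ∀ {z} (z≤F : z ≤ F) → Minimal z →
                  ∀ {w} → Pointwise _≤ᴵ_ w (coord z≤F) → w ≡ coord z≤F
    minimal-vec z≤F min {w} w≤z =
      trans (sym (coord-face (face≤ w)))
            (coord-cong _ _ (min (subst (face w ≤_) (face-coord z≤F) (face-mono w≤z))))

    -- A vector fixed by `flip` must start with `whole`; lowering that coordinate to `left` would
    -- give a face strictly below the minimal `z`.
    reflect≢ : ∀ {z} → z ≤ F → Minimal z → reflect z ≢ z
    reflect≢ {z} z≤F min eq = go (coord z≤F) refl
      where
      fixed : flip (coord z≤F) ≡ coord z≤F
      fixed = face-injective (trans (sym (reflect-≤ z≤F)) (trans eq (sym (face-coord z≤F))))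
      go : ∀ w → w ≢ coord z≤F
      go (left ∷ u)  w≡ with () ← ∷-injectiveˡ (subst (λ w → flip w ≡ w) (sym w≡) fixed)
      go (right ∷ u) w≡ with () ← ∷-injectiveˡ (subst (λ w → flip w ≡ w) (sym w≡) fixed)
      go (whole ∷ u) w≡ with () ← ∷-injectiveˡ
        (trans (minimal-vec z≤F min (subst (Pointwise _≤ᴵ_ (left ∷ u)) w≡ (≤-whole ∷ ≤ᵛ-refl))) (sym w≡))

    -- A face strictly below the edge agrees with z except possibly in the
    -- first coordinate, so there is no chain of three faces ending in the edge.
    edge-height : ∀ {z} (z≤F : z ≤ F) → Minimal z →
                  ∀ {x y} → x ≤ y → y ≤ edge z≤F → y ≢ edge z≤F → x ≡ y
    edge-height z≤F min {x} {y} x≤y y≤e y≢e =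
      injective {_ , x≤F} {_ , y≤F} (go (coord z≤F) (coord x≤F) (coord y≤F) (minimal-vec z≤F min)
        (mono x≤y)
        (subst (Pointwise _≤ᴵ_ (coord y≤F)) (coord-face (face≤ _)) (mono {_ , y≤F} {_ , face≤ _} y≤e))
        λ eq → y≢e (trans (sym (face-coord y≤F)) (cong face eq)))
      where
      y≤F = ≤.trans y≤e (face≤ _)
      x≤F = ≤.trans x≤y y≤F
      go : ∀ {k} (w u v : Vec I (suc k)) → (∀ {w′} → Pointwise _≤ᴵ_ w′ w → w′ ≡ w) →
           Pointwise _≤ᴵ_ u v → Pointwise _≤ᴵ_ v (whole ∷ tail w) →
           v ≢ whole ∷ tail w → u ≡ v
      go (h ∷ w) (i ∷ u) (j ∷ v) min (i≤j ∷ u≤v) (_ ∷ v≤w) v≢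
        with refl ← ∷-injectiveʳ (min (reflᴵ {h} ∷ v≤w))
        with refl ← ∷-injectiveʳ (min (reflᴵ {h} ∷ u≤v))
        with i≤j
      ... | reflᴵ   = refl
      ... | ≤-whole = contradiction refl v≢

    -- `dim` refers to the isomorphism chosen for the edge's own ideal, not to coordinates in `F`,
    -- so the other dimensions are excluded by order alone: 0 would identify `z` with its
    -- reflection, and 2 or more would give a chain of three faces ending in the edge.
    dim-edge : ∀ {z} (z≤F : z ≤ F) → Minimal z → dim (edge z≤F) ≡ 1
    dim-edge {z} z≤F min = go _ refl
      where
      e = edge z≤F
      go : ∀ d → dim e ≡ d → d ≡ 1
      go zero          de = contradiction
        (trans (dim≡0⇒minimal de (reflect≤edge z≤F)) (sym (dim≡0⇒minimal de (z≤edge z≤F))))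
        (reflect≢ z≤F min)
      go (suc zero)    de = refl
      go (suc (suc d)) de = contradiction
        (E.face-injective (edge-height z≤F min (E.face-mono low≤mid) (E.face≤ mid) mid≢e)) λ ()
        where
        module E = Cube (idealCube de)
        -- The chain of three: `top` corresponds to the edge itself, and the second coordinate keeps
        -- `mid` strictly below it.
        low mid top : Vec I (suc (suc d))
        low = left  ∷ left ∷ replicate d left
        mid = whole ∷ left ∷ replicate d left
        top = replicate _ whole
        low≤mid : Pointwise _≤ᴵ_ low mid
        low≤mid = ≤-whole ∷ ≤ᵛ-refl
        mid≢e : E.face mid ≢ e
        mid≢e eq = contradiction
          (E.face-injective (≤.antisym (E.face-mono (≤-replicate-whole mid))
                                       (subst (E.face top ≤_) (sym eq) (E.face≤ top))))
          λ ()

  -- Sums over the enumeration of all faces.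

  faceAt : Fin size → Face
  faceAt = Inverse.to enumeration

  involution-permutation : (σ : Face → Face) → (∀ z → σ (σ z) ≡ z) → Perm.Permutation size size
  involution-permutation σ inv = Perm.permutation π π ππ ππ
    where
    open Inverse enumeration using (from; strictlyInverseˡ; strictlyInverseʳ)
    π = from ∘ σ ∘ faceAt
    ππ : ∀ i → π (π i) ≡ i
    ππ i = trans (cong (from ∘ σ) (strictlyInverseˡ _)) (trans (cong from (inv _)) (strictlyInverseʳ i))

  -- `facesContaining` extended from vertices to arbitrary faces, so that sums can range over the
  -- whole enumeration.
  numberAbove : Face → ℕ → ℕ
  numberAbove z d = length (filter (λ F → (z ≤? F) ×-dec (dim F ≟ d)) faces)

  numberAbove-sum : ∀ z d → + numberAbove z d ≡
    sum (λ F → indicator (z ≤? faceAt F) * indicator (dim (faceAt F) ≟ d))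
  numberAbove-sum z d = begin
    + length (filter P? faces)
      ≡⟨ cong (λ fs → + length (filter P? fs)) (map-tabulate id faceAt) ⟩
    + length (filter P? (tabulate faceAt))  ≡⟨ length-filter-tabulate P? faceAt ⟩
    sum (indicator ∘ P? ∘ faceAt)
      ≡⟨ sum-cong-≗ (λ F → indicator-× (z ≤? faceAt F) (dim (faceAt F) ≟ d)) ⟩
    _ ∎
    where
    open ≡-Reasoning
    P? = λ F → (z ≤? F) ×-dec (dim F ≟ d)

  -- Vertex weights and the difference of the color counts.

  module _ (color : Vertex → Bool) where

    -- The value 0 on faces that are not vertices lets a sum over all faces stand for a sum over
    -- vertices.
    weight? : ∀ {z} → Dec (dim z ≡ 0) → ℤ
    weight? (yes d) = sign (color (_ , d))
    weight? (no _)  = 0ℤ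

    weight : Face → ℤ
    weight z = weight? (dim z ≟ 0)

    verticesColored-difference :
      + verticesColored color true ≡ + verticesColored color false + sum (weight ∘ faceAt)
    verticesColored-difference = subst
      (λ fs → + count true fs ≡ + count false fs + sum (weight ∘ faceAt))
      (sym (map-tabulate id faceAt)) (go faceAt)
      where
      count : Bool → List Face → ℕ
      count c fs = length (filter (λ v → color v Bool.≟ c)
        (mapMaybe (λ x → Maybe.map (x ,_) (dec⇒maybe (dim x ≟ 0))) fs))
      tail-count tail-sum : ∀ {n} → (Fin (suc n) → Face) → ℤ
      tail-count g = + count false (tabulate (g ∘ suc))
      tail-sum g   = sum (weight ∘ g ∘ suc)
      go : ∀ {n} (g : Fin n → Face) →
           + count true (tabulate g) ≡ + count false (tabulate g) + sum (weight ∘ g)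
      go {zero}  g = refl
      go {suc n} g with dim (g zero) ≟ 0
      ... | no _ = trans (go (g ∘ suc)) (cong (_+_ (tail-count g)) (sym (ℤ.+-identityˡ (tail-sum g))))
      ... | yes d with color (g zero , d)
      ...   | true  = trans (cong (_+_ 1ℤ) (go (g ∘ suc)))
                            (+-x∙yz≈y∙xz 1ℤ (tail-count g) (tail-sum g))
      -- The right side gains 1 in the count of `false` vertices and -1 in the weight; `1ℤ + -1ℤ`
      -- computes to `0ℤ`, so the two cancel.
      ...   | false = trans (go (g ∘ suc))
                            (trans (sym (ℤ.+-identityˡ (tail-count g + tail-sum g)))
                                   (interchange 1ℤ -1ℤ (tail-count g) (tail-sum g)))

    -- Cancellation of weights on cubes and over links.

    module _ (bicoloring : IsBicoloring color) where

      -- Two endpoints of the same color would coincide, by the uniqueness of the endpoint of `e`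
      -- with that color.
      endpoints-colored : ∀ {e} → dim e ≡ 1 → (v w : Vertex) → proj₁ v ≤ e → proj₁ w ≤ e →
                          proj₁ v ≢ proj₁ w → color v ≢ color w
      endpoints-colored {e} de v w v≤e w≤e v≢w same with bicoloring e de (color w)
      ... | _ , _ , unique = v≢w (trans (sym (unique {v} (v≤e , same))) (unique {w} (w≤e , refl)))

      -- The summand is antisymmetric under reflection: inside `F` each vertex is exchanged with the
      -- other end of an edge, of opposite weight, and outside `F` the indicator is zero.
      sum-weight-cube : ∀ {F k} → IdealIsCube _≤_ F (suc k) →
                        sum (λ i → weight (faceAt i) * indicator (faceAt i ≤? F)) ≡ 0ℤ
      sum-weight-cube {F} cube =
        sum-antisymmetric _ (involution-permutation reflect reflect-involutive) λ i →
          trans (cong f (Inverse.strictlyInverseˡ enumeration _)) (f-reflect (faceAt i))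
        where
        open Reflection cube
        f : Face → ℤ
        f z = weight z * indicator (z ≤? F)

        weight-reflect : ∀ {z} → z ≤ F → weight (reflect z) ≡ - weight z
        weight-reflect {z} z≤F = go (dim (reflect z) ≟ 0) (dim z ≟ 0)
          where
          go : (d : Dec (dim (reflect z) ≡ 0)) (d′ : Dec (dim z ≡ 0)) → weight? d ≡ - weight? d′
          go (no _)   (no _)  = refl
          -- The mixed cases cannot occur, since reflection preserves minimality in both directions.
          go (no ¬d)  (yes d) = contradiction
            (minimal⇒dim≡0 (reflect-minimal z≤F (dim≡0⇒minimal d))) ¬d
          go (yes d)  (no ¬d) = contradiction
            (subst (λ y → dim y ≡ 0) (reflect-involutive z)
              (minimal⇒dim≡0 (reflect-minimal (reflect≤ z≤F) (dim≡0⇒minimal d)))) ¬d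
          go (yes d)  (yes d′) = sign-≢ (endpoints-colored (dim-edge z≤F min) (_ , d) (_ , d′)
            (reflect≤edge z≤F) (z≤edge z≤F) (reflect≢ z≤F min))
            where
            min : Minimal z
            min = dim≡0⇒minimal d′

        f-reflect : ∀ z → f (reflect z) ≡ - f z
        f-reflect z = go (z ≤? F) (reflect z ≤? F)
          where
          go : (d : Dec (z ≤ F)) (d′ : Dec (reflect z ≤ F)) →
               weight (reflect z) * indicator d′ ≡ - (weight z * indicator d)
          go (yes z≤F) (yes _) = trans (cong (_* 1ℤ) (weight-reflect z≤F))
            (sym (ℤ.neg-distribˡ-* (weight z) 1ℤ))
          go (yes z≤F) (no ¬p) = contradiction (reflect≤ z≤F) ¬p
          go (no z≰F)  (yes p) = contradiction (subst (_≤ F) (reflect-≰ z≰F) p) z≰F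
          go (no z≰F)  (no _)  = trans (ℤ.*-zeroʳ (weight (reflect z))) (cong -_ (sym (ℤ.*-zeroʳ (weight z))))

      -- Double counting of pairs of a vertex and a face above it: summing first over the vertices
      -- of a fixed face of dimension `suc j` gives zero by `sum-weight-cube`, the positive
      -- dimension supplying a coordinate to reflect in.
      sum-weight-numberAbove : ∀ j → sum (λ i → weight (faceAt i) * + numberAbove (faceAt i) (suc j)) ≡ 0ℤ
      sum-weight-numberAbove j = begin
        sum (λ i → w i * + numberAbove (faceAt i) (suc j))
          ≡⟨ sum-cong-≗ (λ i → cong (w i *_) (numberAbove-sum (faceAt i) (suc j))) ⟩
        sum (λ i → w i * sum (λ F → below i F * top F))
          ≡⟨ sum-cong-≗ (λ i → *-distribˡ-sum (w i) (λ F → below i F * top F)) ⟩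
        sum (λ i → sum (λ F → w i * (below i F * top F)))
          ≡⟨ ∑-comm (λ i F → w i * (below i F * top F)) ⟩
        sum (λ F → sum (λ i → w i * (below i F * top F)))
          ≡⟨ sum-zero _ (λ F → trans
               (sum-cong-≗ (λ i → sym (ℤ.*-assoc (w i) (below i F) (top F))))
               (trans (sym (*-distribʳ-sum (top F) (λ i → w i * below i F)))
                      (vanish F (dim (faceAt F) ≟ suc j)))) ⟩
        0ℤ ∎
        where
        open ≡-Reasoning
        w : Fin size → ℤ
        w i = weight (faceAt i)
        below : Fin size → Fin size → ℤ
        below i F = indicator (faceAt i ≤? faceAt F)
        top : Fin size → ℤ
        top F = indicator (dim (faceAt F) ≟ suc j)
        vanish : ∀ F (d : Dec (dim (faceAt F) ≡ suc j)) → sum (λ i → w i * below i F) * indicator d ≡ 0ℤ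
        vanish F (yes d) = cong (_* 1ℤ) (sum-weight-cube (idealCube d))
        vanish F (no _)  = ℤ.*-zeroʳ (sum (λ i → w i * below i F))

      sum-weight-Eulerian : ∀ {n} → IsEulerian n → sum (weight ∘ faceAt) * n ≡ 0ℤ
      sum-weight-Eulerian {n} eulerian = begin
        sum (weight ∘ faceAt) * n
          ≡⟨ *-distribʳ-sum n (weight ∘ faceAt) ⟩
        sum (λ i → weight (faceAt i) * n)
          ≡⟨ sum-cong-≗ (λ i → link (faceAt i) (dim (faceAt i) ≟ 0)) ⟩
        sum (λ i → weight (faceAt i) * χ (faceAt i))
          ≡⟨ sum-*-foldr-zero (weight ∘ faceAt) (term ∘ faceAt) term-zero (upTo dimension) ⟩
        0ℤ ∎
        where
        open ≡-Reasoning
        term : Face → ℕ → ℤ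
        term z j = (-1ℤ ^ j) * + numberAbove z (suc j)
        χ : Face → ℤ
        χ z = foldr _+_ 0ℤ (map (term z) (upTo dimension))
        -- The Eulerian hypothesis speaks of vertices only; at every other face both products vanish
        -- with the weight.
        link : ∀ z (d : Dec (dim z ≡ 0)) → weight? d * n ≡ weight? d * χ z
        link z (yes d) = cong (weight? {z} (yes d) *_) (sym (eulerian (z , d)))
        link z (no _)  = refl
        term-zero : ∀ j → sum (λ i → weight (faceAt i) * term (faceAt i) j) ≡ 0ℤ
        term-zero j = begin
          sum (λ i → w i * (c * N i)) ≡⟨ sum-cong-≗ (λ i → *-x∙yz≈y∙xz (w i) c (N i)) ⟩
          sum (λ i → c * (w i * N i)) ≡⟨ *-distribˡ-sum c (λ i → w i * N i) ⟨
          c * sum (λ i → w i * N i)   ≡⟨ cong (c *_) (sum-weight-numberAbove j) ⟩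
          c * 0ℤ                      ≡⟨ ℤ.*-zeroʳ c ⟩
          0ℤ                          ∎
          where
          c = -1ℤ ^ j
          w N : Fin size → ℤ
          w i = weight (faceAt i)
          N i = + numberAbove (faceAt i) (suc j)

-- From zero total weight to equal color classes.

theorem2p2 : ∀ {a ℓ : Level} (n : ℤ) → n ≢ 0ℤ →
    (K : CubicalComplex a ℓ) → (let open CubicalComplex K) →
    (color : Vertex → Bool) → IsBicoloring color → IsEulerian n →
    (verticesColored color true ≡ verticesColored color false) ×
    (2 ∣ length vertices)
theorem2p2 n n≢0 K color bicoloring eulerian = equal , divides (verticesColored color true) even
  where
  open CubicalComplex K
  open ≡-Reasoning
  sum≡0 : sum (weight K color ∘ faceAt K) ≡ 0ℤ
  -- The integers have no zero divisors, so the nonzero factor `n` can be cancelled.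
  sum≡0 = [ id , (λ n≡0 → contradiction n≡0 n≢0) ]′
    (ℤ.i*j≡0⇒i≡0∨j≡0 (sum (weight K color ∘ faceAt K)) (sum-weight-Eulerian K color bicoloring eulerian))
  equal : verticesColored color true ≡ verticesColored color false
  equal = ℤ.+-injective (begin
    + verticesColored color true
      ≡⟨ verticesColored-difference K color ⟩
    + verticesColored color false + sum (weight K color ∘ faceAt K)
      ≡⟨ cong (_+_ (+ verticesColored color false)) sum≡0 ⟩
    + verticesColored color false + 0ℤ ≡⟨ ℤ.+-identityʳ _ ⟩
    + verticesColored color false      ∎)
  even : length vertices ≡ verticesColored color true ℕ.* 2
  even = begin
    length vertices ≡⟨ length-filter-bool color vertices ⟩
    verticesColored color true ℕ.+ verticesColored color false
      ≡⟨ cong (verticesColored color true ℕ.+_) (trans (sym equal) (sym (ℕ.+-identityʳ _))) ⟩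
    2 ℕ.* verticesColored color true ≡⟨ ℕ.*-comm 2 (verticesColored color true) ⟩
    verticesColored color true ℕ.* 2 ∎
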